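{- Let $G$ be the infinite triangular grid. The code $C=\{v(i,j)\mid i\equiv 0 \pmod 2,\ j\equiv 0\pmod 2\}$ is self-locating-dominating in $G$, and therefore also solid-locating-dominating. The density of $C$ equals $1/4$, and there exists no self-locating-dominating code and no solid-locating-dominating code in $G$ with density smaller than $1/4$.
   Context: The infinite triangular grid $G=(V,E)$ has vertex set $V=\{v(i,j)\mid i,j\in\mathbb{Z}\}$ where $v(i,j)=i(1,0)+j(\tfrac12,\tfrac{\sqrt3}{2})\in\mathbb{R}^2$, and two vertices are adjacent iff their Euclidean distance is $1$. Let $V_n=\{v(i,j)\mid |i|,|j|\le n\}$; the density of a code $C\subseteq V$ is $D(C)=\limsup_{n\to\infty}|C\cap V_n|/|V_n|$. $N[v]$ is the closed neighbourhood of $v$, and for a code (nonempty subset) $C$, $I(C;v)=N[v]\cap C$. A code $C$ is self-locating-dominating if for every $u\in V\setminus C$, $I(C;u)\ne\emptyset$ and $\bigcap_{c\in I(C;u)}N[c]=\{u\}$. A code $C$ is solid-locating-dominating if for all distinct $u,v\in V\setminus C$, $I(C;u)\setminus I(C;v)\neq\emptyset$. -}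

module Defs where

open import Data.Integer as ℤ using (ℤ; +_)
open import Data.Integer.Divisibility using (_∣_)
open import Data.List using (List; length)
import Data.List.Membership.Propositional as List
open import Data.List.Relation.Unary.Unique.Propositional using (Unique)
open import Data.Nat as ℕ using (ℕ; suc)
open import Data.Product using (∃; ∃-syntax; Σ-syntax; _×_; _,_; proj₁)
open import Data.Rational as ℚ using (ℚ; ½; 1ℚ; _+_; _*_; _-_; _/_; _<_; _≤_)
open import Data.Sum using (_⊎_)
open import Level using (0ℓ)
open import Relation.Binary.PropositionalEquality using (_≡_; _≢_)
open import Relation.Unary
  using (Pred; _∈_; _∉_; _∩_; _∖_; _≐_; ｛_｝; ⋂; Satisfiable)

------------------------------------------------------------------------
-- The infinite triangular grid

-- A pair (x , y) stands for the point (x , y √3) of the Euclidean plane.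
-- All vertices of the grid are of this form with x and y rational.
Point : Set
Point = ℚ × ℚ

-- The Euclidean distance itself may be irrational; its square is not:
-- (x - x′)² + (y √3 - y′ √3)².
distance² : Point → Point → ℚ
distance² (x , y) (x′ , y′) =
  (x - x′) * (x - x′) + (+ 3 / 1) * ((y - y′) * (y - y′))

-- (i , j) stands for the vertex v(i,j).
V : Set
V = ℤ × ℤ

-- v(i,j) = i (1 , 0) + j (1/2 , √3/2)
position : V → Point
position (i , j) = (i / 1) + (j / 1) * ½ , (j / 1) * ½

-- The distance is 1 iff its square is 1.
Adjacent : V → V → Set
Adjacent u w = distance² (position u) (position w) ≡ 1ℚ

N[_] : V → Pred V 0ℓ
N[ u ] w = w ≡ u ⊎ Adjacent u w

------------------------------------------------------------------------
-- Codes

I : Pred V 0ℓ → V → Pred V 0ℓ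
I C u = N[ u ] ∩ C

IsCode : Pred V 0ℓ → Set
IsCode C = Satisfiable C

SelfLocatingDominating : Pred V 0ℓ → Set
SelfLocatingDominating C = IsCode C ×
  (∀ u → u ∉ C →
    Satisfiable (I C u) × ⋂ (Σ[ c ∈ V ] c ∈ I C u) (λ c → N[ proj₁ c ]) ≐ ｛ u ｝)

SolidLocatingDominating : Pred V 0ℓ → Set
SolidLocatingDominating C = IsCode C ×
  (∀ u v → u ∉ C → v ∉ C → u ≢ v → Satisfiable (I C u ∖ I C v))

------------------------------------------------------------------------
-- Limits superior

-- A sequence of rationals is given by its graph: S n r says that r is the
-- n-th term. This allows for sequences that are not computable.
Sequence : Set₁
Sequence = ℕ → Pred ℚ 0ℓ

-- The limit superior inf_N sup_{n≥N} is an extended real number, described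
-- by the rationals above it and those below it.

-- lim sup S < q
LimSup_<_ : Sequence → ℚ → Set
LimSup S < q = ∃[ p ] p < q ×
  (∃[ N ] ∀ n → N ℕ.≤ n → ∀ r → S n r → r ≤ p)

-- lim sup S > q
LimSup_>_ : Sequence → ℚ → Set
LimSup S > q = ∃[ p ] q < p ×
  (∀ N → ∃[ n ] N ℕ.≤ n × (∃[ r ] S n r × p ≤ r))

-- lim sup S = q
LimSup_≈_ : Sequence → ℚ → Set
LimSup S ≈ q =
  (∀ p → q < p → LimSup S < p) × (∀ p → p < q → LimSup S > p)

------------------------------------------------------------------------
-- Density

HasCardinality : ∀ {A : Set} → Pred A 0ℓ → ℕ → Set
HasCardinality P k =
  ∃[ xs ] Unique xs × (List._∈ xs) ≐ P × length xs ≡ k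

V[_] : ℕ → Pred V 0ℓ
V[ n ] (i , j) = ℤ.∣ i ∣ ℕ.≤ n × ℤ.∣ j ∣ ℕ.≤ n

-- The sequence |C ∩ V[ n ]| / |V[ n ]|. Codes are not assumed to be
-- decidable, so |C ∩ V[ n ]| is not a function of C and n; classically it
-- exists for all C and n. The denominator is positive as V[ n ] contains
-- the origin.
densities : Pred V 0ℓ → Sequence
densities C n r = ∃[ k ] ∃[ m ]
  HasCardinality (C ∩ V[ n ]) k × HasCardinality V[ n ] (suc m) ×
  r ≡ + k / suc m

Density_≈_ : Pred V 0ℓ → ℚ → Set
Density C ≈ q = LimSup densities C ≈ q

Density_<_ : Pred V 0ℓ → ℚ → Set
Density C < q = LimSup densities C < q

------------------------------------------------------------------------
-- The code { v(i,j) ∣ i ≡ 0 (mod 2), j ≡ 0 (mod 2) }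

evenCode : Pred V 0ℓ
evenCode (i , j) = (+ 2 ∣ i) × (+ 2 ∣ j)

{-# OPTIONS --safe #-}

-- Lower bound: in a code C with either property, I(C;u) ⊆ I(C;v) never holds
-- for distinct non-codewords u and v. A non-codeword u then has at least two
-- codewords in its neighbourhood: if w were the only one, a common neighbour
-- x of u and w would be no codeword, but then I(C;u) = {w} ⊆ I(C;x). Let every
-- codeword hand two tokens to itself and one to each of its six neighbours;
-- every vertex receives at least two, so |V_n| ≤ 4 |C ∩ V_{n+1}|. The argument
-- is classical in C, which is harmless as the claim is negative.
--
-- Even code: every non-codeword u lies midway between two codewords u + d and
-- u - d at distance 1 from it, and N[u + d] and N[u - d] meet only in u.

module Submission where

open import Defs
open import Data.Empty using (⊥-elim)
open import Data.Fin as Fin using (Fin)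
import Data.Fin.Properties as Fin
open import Data.Integer as ℤ using (ℤ; +_; -_; ∣_∣)
import Data.Integer.Properties as ℤ
open import Data.Integer.DivMod using (_%ℕ_; _/ℕ_; n%ℕd<d; a≡a%ℕn+[a/ℕn]*n)
open import Data.Integer.Divisibility using (_∣_)
open import Data.Integer.Divisibility.Signed as Signed using (∣ᵤ⇒∣; ∣⇒∣ᵤ)
import Data.Integer.Tactic.RingSolver as ℤ-Solver
open import Data.List
  using (List; []; _∷_; length; map; cartesianProduct; allFin; lookup)
open import Data.List.Properties using (length-map; length-++)
open import Data.List.Membership.Propositional using (find) renaming (_∈_ to _∈ˡ_)
import Data.List.Membership.DecPropositional as DecMembership
open import Data.List.Membership.Propositional.Properties
  using (∈-lookup; ∈-map⁺; ∈-map⁻; ∈-cartesianProduct⁺; ∈-cartesianProduct⁻; ∈-allFin)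
open import Data.List.Relation.Binary.Subset.Propositional using () renaming (_⊆_ to _⊆ˡ_)
open import Data.List.Relation.Unary.All as All using (All; []; _∷_)
open import Data.List.Relation.Unary.Any as Any using (Any; here; there; index)
open import Data.List.Relation.Unary.Any.Properties using (lookup-index)
open import Data.List.Relation.Unary.Unique.Propositional using (Unique; []; _∷_)
import Data.List.Relation.Unary.Unique.Propositional.Properties as Unique
open import Data.Nat as ℕ using (ℕ; zero; suc; z≤n; s≤s)
import Data.Nat.Coprimality as Coprime
import Data.Nat.Divisibility as ℕ
import Data.Nat.DivMod as ℕ
import Data.Nat.Properties as ℕ
import Data.Nat.Tactic.RingSolver as ℕ-Solver
open import Data.Product using (_×_; _,_; ∃; ∃-syntax; proj₁; proj₂)
open import Data.Product.Properties using (≡-dec)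
open import Data.Rational as ℚ using (ℚ; mkℚ; ↥_; ½; _/_)
import Data.Rational.Properties as ℚ
open import Data.Rational.Solver using (module +-*-Solver)
open import Data.Rational.Unnormalised as ℚᵘ using (mkℚᵘ)
import Data.Rational.Unnormalised.Properties as ℚᵘ
open import Data.Sum using (_⊎_; inj₁; inj₂)
open import Function using (_∘_)
open import Level using (0ℓ)
open import Relation.Binary.PropositionalEquality
  using (_≡_; _≢_; refl; sym; trans; cong; cong₂; subst; subst₂; module ≡-Reasoning)
open import Relation.Nullary using (¬_; Dec; yes; no; contradiction)
open import Relation.Nullary.Decidable
  using (from-yes; ¬?; _→-dec_; _×-dec_; map′; decidable-stable; ¬¬-excluded-middle)
open import Relation.Nullary.Negation using (¬¬-Monad)
open import Relation.Unary using (Pred; _∈_; _∉_; _⊆_; _∩_; _≐_)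
open import Algebra.Properties.Group ℚ.+-0-group using (⁻¹-involutive)

-- Coordinate arithmetic on vertices.

infixl 6 _⊕_ _⊖_

_⊕_ _⊖_ : V → V → V
(i , j) ⊕ (i′ , j′) = i ℤ.+ i′ , j ℤ.+ j′
(i , j) ⊖ (i′ , j′) = i ℤ.- i′ , j ℤ.- j′

⊕-⊖ : ∀ u w → w ⊕ (u ⊖ w) ≡ u
⊕-⊖ (i , j) (k , l) = cong₂ _,_ (lemma i k) (lemma j l)
  where
  lemma : ∀ i k → k ℤ.+ (i ℤ.- k) ≡ i
  lemma = ℤ-Solver.solve-∀

⊖-⊖ : ∀ u w → u ⊖ (u ⊖ w) ≡ w
⊖-⊖ (i , j) (k , l) = cong₂ _,_ (lemma i k) (lemma j l)
  where
  lemma : ∀ i k → i ℤ.- (i ℤ.- k) ≡ k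
  lemma = ℤ-Solver.solve-∀

⊖-difference : ∀ u e f → (u ⊖ e) ⊖ (u ⊖ f) ≡ f ⊖ e
⊖-difference (i , j) (k , l) (m , n) = cong₂ _,_ (lemma i k m) (lemma j l n)
  where
  lemma : ∀ i k m → (i ℤ.- k) ℤ.- (i ℤ.- m) ≡ m ℤ.- k
  lemma = ℤ-Solver.solve-∀

opposite-difference : ∀ u d w → ((u ⊕ d) ⊖ w) ⊖ ((u ⊖ d) ⊖ w) ≡ d ⊕ d
opposite-difference (i , j) (k , l) (m , n) = cong₂ _,_ (lemma i k m) (lemma j l n)
  where
  lemma : ∀ i k m → ((i ℤ.+ k) ℤ.- m) ℤ.- ((i ℤ.- k) ℤ.- m) ≡ k ℤ.+ k
  lemma = ℤ-Solver.solve-∀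

⊕-⊖-cancel : ∀ u d w → (u ⊕ d) ⊖ w ≡ d → u ≡ w
⊕-⊖-cancel (i , j) (k , l) (m , n) eq =
  cong₂ _,_ (lemma i k m (cong proj₁ eq)) (lemma j l n (cong proj₂ eq))
  where
  rearrange : ∀ i k m → i ≡ ((i ℤ.+ k) ℤ.- m) ℤ.- k ℤ.+ m
  rearrange = ℤ-Solver.solve-∀
  simplify : ∀ k m → k ℤ.- k ℤ.+ m ≡ m
  simplify = ℤ-Solver.solve-∀
  lemma : ∀ i k m → (i ℤ.+ k) ℤ.- m ≡ k → i ≡ m
  lemma i k m eq = trans (rearrange i k m)
    (trans (cong (λ x → x ℤ.- k ℤ.+ m) eq) (simplify k m))

infix 4 _≟_

_≟_ : (u w : V) → Dec (u ≡ w)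
_≟_ = ≡-dec ℤ._≟_ ℤ._≟_

open DecMembership _≟_ using (_∈?_)

-- Euclidean distance as an integral quadratic form.

-- The squared Euclidean length of the vector i (1, 0) + j (1/2, √3/2).
norm : V → ℤ
norm (i , j) = i ℤ.* i ℤ.+ i ℤ.* j ℤ.+ j ℤ.* j

-- For a variable `i`, the normalisation inside `i / 1` is stuck; the explicit form lets rational
-- arithmetic compute.
i/1≡mkℚ : ∀ i → i / 1 ≡ mkℚ i 0 (Coprime.sym (Coprime.1-coprimeTo ∣ i ∣))
i/1≡mkℚ i = ℚ.fromℚᵘ-toℚᵘ (mkℚ i 0 (Coprime.sym (Coprime.1-coprimeTo ∣ i ∣)))

/1-injective : ∀ {i j} → i / 1 ≡ j / 1 → i ≡ j
/1-injective {i} {j} eq =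
  cong ↥_ (trans (sym (i/1≡mkℚ i)) (trans eq (i/1≡mkℚ j)))

/1-homo-+ : ∀ i j → i / 1 ℚ.+ j / 1 ≡ (i ℤ.+ j) / 1
/1-homo-+ i j = trans (cong₂ ℚ._+_ (i/1≡mkℚ i) (i/1≡mkℚ j))
  (cong (_/ 1) (cong₂ ℤ._+_ (ℤ.*-identityʳ i) (ℤ.*-identityʳ j)))

/1-homo-* : ∀ i j → (i / 1) ℚ.* (j / 1) ≡ (i ℤ.* j) / 1
/1-homo-* i j = cong₂ ℚ._*_ (i/1≡mkℚ i) (i/1≡mkℚ j)

/1-homo-neg : ∀ i → ℚ.- (i / 1) ≡ (- i) / 1
/1-homo-neg (+ zero)     = refl
/1-homo-neg (+ suc n)    = refl
/1-homo-neg (ℤ.-[1+ n ]) = ⁻¹-involutive _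

/1-homo-- : ∀ i j → i / 1 ℚ.- j / 1 ≡ (i ℤ.- j) / 1
/1-homo-- i j = trans (cong (i / 1 ℚ.+_) (/1-homo-neg j)) (/1-homo-+ i (- j))

-- Completing the square: (x + y/2)² + 3 (y/2)² = x² + xy + y², with x and y the coordinate
-- differences.
distance²-position : ∀ u w → distance² (position u) (position w) ≡ norm (u ⊖ w) / 1
distance²-position (i , j) (k , l) = begin
  distance² (position (i , j)) (position (k , l))
    ≡⟨ identity (i / 1) (j / 1) (k / 1) (l / 1) ⟩
  x ℚ.* x ℚ.+ x ℚ.* y ℚ.+ y ℚ.* y
    ≡⟨ cong₂ (λ a b → a ℚ.* a ℚ.+ a ℚ.* b ℚ.+ b ℚ.* b) (/1-homo-- i k) (/1-homo-- j l) ⟩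
  (a / 1) ℚ.* (a / 1) ℚ.+ (a / 1) ℚ.* (b / 1) ℚ.+ (b / 1) ℚ.* (b / 1)
    ≡⟨ cong₂ ℚ._+_ (cong₂ ℚ._+_ (/1-homo-* a a) (/1-homo-* a b)) (/1-homo-* b b) ⟩
  (a ℤ.* a) / 1 ℚ.+ (a ℤ.* b) / 1 ℚ.+ (b ℤ.* b) / 1
    ≡⟨ cong (ℚ._+ (b ℤ.* b) / 1) (/1-homo-+ (a ℤ.* a) (a ℤ.* b)) ⟩
  (a ℤ.* a ℤ.+ a ℤ.* b) / 1 ℚ.+ (b ℤ.* b) / 1
    ≡⟨ /1-homo-+ (a ℤ.* a ℤ.+ a ℤ.* b) (b ℤ.* b) ⟩
  norm (a , b) / 1 ∎
  where
  open ≡-Reasoning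
  a = i ℤ.- k
  b = j ℤ.- l
  x = i / 1 ℚ.- k / 1
  y = j / 1 ℚ.- l / 1
  identity : ∀ p q r s →
    distance² (p ℚ.+ q ℚ.* ½ , q ℚ.* ½) (r ℚ.+ s ℚ.* ½ , s ℚ.* ½) ≡
    (p ℚ.- r) ℚ.* (p ℚ.- r) ℚ.+ (p ℚ.- r) ℚ.* (q ℚ.- s) ℚ.+ (q ℚ.- s) ℚ.* (q ℚ.- s)
  identity = solve 4 (λ p q r s →
    let h = con ½
        x = (p :+ q :* h) :- (r :+ s :* h)
        y = q :* h :- s :* h
    in x :* x :+ con (+ 3 / 1) :* (y :* y) :=
       (p :- r) :* (p :- r) :+ (p :- r) :* (q :- s) :+ (q :- s) :* (q :- s)) refl
    where open +-*-Solver

-- Closed neighbourhoods as translates of a finite list.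

-- Being a neighbour depends only on a difference of vertices, so with explicit lists `from-yes`
-- settles geometric facts by evaluation.
units disc : List V
units = (+ 1 , + 0) ∷ (- + 1 , + 0) ∷ (+ 0 , + 1) ∷ (+ 0 , - + 1)
      ∷ (+ 1 , - + 1) ∷ (- + 1 , + 1) ∷ []
disc = (+ 0 , + 0) ∷ units

range : ℕ → List ℤ
range zero    = + 0 ∷ []
range (suc n) = + suc n ∷ ℤ.-[1+ n ] ∷ range n

square : ℕ → List V
square n = cartesianProduct (range n) (range n)

∈-range⁺ : ∀ {n i} → ∣ i ∣ ℕ.≤ n → i ∈ˡ range n
∈-range⁺ {zero} {+ zero} z≤n = here refl
∈-range⁺ {suc n} {i} i≤1+n with ℕ.m≤n⇒m<n∨m≡n i≤1+n
... | inj₁ (s≤s i≤n) = there (there (∈-range⁺ i≤n))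
∈-range⁺ {suc n} {+ .(suc n)}     _ | inj₂ refl = here refl
∈-range⁺ {suc n} {ℤ.-[1+ .n ]}    _ | inj₂ refl = there (here refl)

∈-range⁻ : ∀ {n i} → i ∈ˡ range n → ∣ i ∣ ℕ.≤ n
∈-range⁻ {zero}  (here refl)         = z≤n
∈-range⁻ {suc n} (here refl)         = ℕ.≤-refl
∈-range⁻ {suc n} (there (here refl)) = ℕ.≤-refl
∈-range⁻ {suc n} (there (there i∈))  = ℕ.m≤n⇒m≤1+n (∈-range⁻ i∈)

i*i≡+∣i∣*∣i∣ : ∀ i → i ℤ.* i ≡ + (∣ i ∣ ℕ.* ∣ i ∣)
i*i≡+∣i∣*∣i∣ (+ zero)     = refl
i*i≡+∣i∣*∣i∣ (+ suc n)    = refl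
i*i≡+∣i∣*∣i∣ ℤ.-[1+ n ]   = refl

-- Four times the norm is (2i + j)² + 3j², so ∣j∣ ≥ 2 would give 12 ≤ 4.
norm≡1⇒∣j∣≤1 : ∀ i j → norm (i , j) ≡ + 1 → ∣ j ∣ ℕ.≤ 1
norm≡1⇒∣j∣≤1 i j eq = ℕ.≮⇒≥ λ 2≤∣j∣ →
  ℕ.<⇒≱ (ℕ.m≤m+n 5 7) (begin
    3 ℕ.* (2 ℕ.* 2)         ≤⟨ ℕ.*-monoʳ-≤ 3 (ℕ.*-mono-≤ 2≤∣j∣ 2≤∣j∣) ⟩
    3 ℕ.* (∣ j ∣ ℕ.* ∣ j ∣) ≤⟨ ℕ.m≤n+m _ (∣ x ∣ ℕ.* ∣ x ∣) ⟩
    ∣ x ∣ ℕ.* ∣ x ∣ ℕ.+ 3 ℕ.* (∣ j ∣ ℕ.* ∣ j ∣) ≡⟨ ℤ.+-injective squares ⟩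
    4 ∎)
  where
  open ℕ.≤-Reasoning
  x = + 2 ℤ.* i ℤ.+ j
  identity : ∀ i j → (+ 2 ℤ.* i ℤ.+ j) ℤ.* (+ 2 ℤ.* i ℤ.+ j) ℤ.+ + 3 ℤ.* (j ℤ.* j) ≡
    + 4 ℤ.* (i ℤ.* i ℤ.+ i ℤ.* j ℤ.+ j ℤ.* j)
  identity = ℤ-Solver.solve-∀
  squares : + (∣ x ∣ ℕ.* ∣ x ∣ ℕ.+ 3 ℕ.* (∣ j ∣ ℕ.* ∣ j ∣)) ≡ + 4
  squares = trans
    (cong₂ ℤ._+_ (sym (i*i≡+∣i∣*∣i∣ x))
      (trans (ℤ.pos-* 3 (∣ j ∣ ℕ.* ∣ j ∣)) (cong (+ 3 ℤ.*_) (sym (i*i≡+∣i∣*∣i∣ j)))))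
    (trans (identity i j) (cong (+ 4 ℤ.*_) eq))

-- The norm is symmetric in the coordinates, so both are at most 1 in absolute value; the nine
-- remaining vectors are checked one by one.
norm≡1⇒∈units : ∀ e → norm e ≡ + 1 → e ∈ˡ units
norm≡1⇒∈units (i , j) eq = All.lookup
  (from-yes (All.all? (λ e → (norm e ℤ.≟ + 1) →-dec (e ∈? units)) (square 1)))
  (∈-cartesianProduct⁺
    (∈-range⁺ (norm≡1⇒∣j∣≤1 j i (trans (swap i j) eq)))
    (∈-range⁺ (norm≡1⇒∣j∣≤1 i j eq)))
  eq
  where
  swap : ∀ i j → j ℤ.* j ℤ.+ j ℤ.* i ℤ.+ i ℤ.* i ≡ i ℤ.* i ℤ.+ i ℤ.* j ℤ.+ j ℤ.* j
  swap = ℤ-Solver.solve-∀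

u⊖u≡0 : ∀ u → u ⊖ u ≡ (+ 0 , + 0)
u⊖u≡0 (i , j) = cong₂ _,_ (ℤ.+-inverseʳ i) (ℤ.+-inverseʳ j)

⊖≡0⇒≡ : ∀ u w → u ⊖ w ≡ (+ 0 , + 0) → w ≡ u
⊖≡0⇒≡ (i , j) (k , l) eq = sym (cong₂ _,_
  (ℤ.i-j≡0⇒i≡j i k (cong proj₁ eq)) (ℤ.i-j≡0⇒i≡j j l (cong proj₂ eq)))

N⇒⊖∈disc : ∀ {u w} → w ∈ N[ u ] → u ⊖ w ∈ˡ disc
N⇒⊖∈disc {u} (inj₁ refl) = here (u⊖u≡0 u)
N⇒⊖∈disc {u} {w} (inj₂ adjacent) = there (norm≡1⇒∈units (u ⊖ w)
  (/1-injective (trans (sym (distance²-position u w)) adjacent)))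

⊖∈disc⇒N : ∀ {u w} → u ⊖ w ∈ˡ disc → w ∈ N[ u ]
⊖∈disc⇒N {u} {w} (here u⊖w≡0) = inj₁ (⊖≡0⇒≡ u w u⊖w≡0)
⊖∈disc⇒N {u} {w} (there u⊖w∈) = inj₂ (trans (distance²-position u w)
  (cong (_/ 1) (All.lookup (from-yes (All.all? (λ e → norm e ℤ.≟ + 1) units)) u⊖w∈)))

N? : ∀ u w → Dec (w ∈ N[ u ])
N? u w = map′ ⊖∈disc⇒N N⇒⊖∈disc (u ⊖ w ∈? disc)

N-sym : ∀ {u w} → w ∈ N[ u ] → u ∈ N[ w ]
N-sym {u} {w} w∈Nu = ⊖∈disc⇒N (subst (_∈ˡ disc) (0⊖ u w)
  (All.lookup (from-yes (All.all? (λ e → (+ 0 , + 0) ⊖ e ∈? disc) disc)) (N⇒⊖∈disc w∈Nu)))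
  where
  lemma : ∀ i k → + 0 ℤ.- (i ℤ.- k) ≡ k ℤ.- i
  lemma = ℤ-Solver.solve-∀
  0⊖ : ∀ u w → (+ 0 , + 0) ⊖ (u ⊖ w) ≡ w ⊖ u
  0⊖ (i , j) (k , l) = cong₂ _,_ (lemma i k) (lemma j l)

-- The differences e and f of `u ⊕ d` and `u ⊖ d` from `w` lie in `disc` and satisfy e - f = 2d.
-- Inspection of `disc` leaves only e = d.
opposite-neighbours : ∀ {u d w} → d ∈ˡ units → w ∈ N[ u ⊕ d ] → w ∈ N[ u ⊖ d ] → u ≡ w
opposite-neighbours {u} {d} {w} d∈ w∈⊕ w∈⊖ = ⊕-⊖-cancel u d w
  (All.lookup (All.lookup (All.lookup touching d∈) (N⇒⊖∈disc w∈⊕)) (N⇒⊖∈disc w∈⊖)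
    (opposite-difference u d w))
  where
  touching : All (λ d → All (λ e → All (λ f → e ⊖ f ≡ d ⊕ d → e ≡ d) disc) disc) units
  touching = from-yes (All.all? (λ d → All.all? (λ e → All.all? (λ f →
    (e ⊖ f ≟ d ⊕ d) →-dec (e ≟ d)) disc) disc) units)

⊖-unit-neighbour : ∀ u {d} → d ∈ˡ units → u ⊖ d ∈ N[ u ]
⊖-unit-neighbour u {d} d∈ = ⊖∈disc⇒N (subst (_∈ˡ disc) (sym (⊖-⊖ u d)) (there d∈))

-- Every edge lies in a triangle: a sixth of a turn takes the unit `u ⊖ w` to another unit f at
-- distance 1 from it, and `u ⊖ f` is the third corner.
common-neighbour : ∀ {u w} → w ∈ N[ u ] → w ≢ u →
  ∃[ x ] x ≢ u × x ≢ w × x ∈ N[ u ] × x ∈ N[ w ]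
common-neighbour {u} {w} w∈Nu w≢u with N⇒⊖∈disc w∈Nu
... | here u⊖w≡0 = contradiction (⊖≡0⇒≡ u w u⊖w≡0) w≢u
... | there e∈ with find (All.lookup rotation e∈)
  where
  rotation : All (λ e → Any (λ f → f ≢ e × f ⊖ e ∈ˡ disc) units) units
  rotation = from-yes (All.all? (λ e → Any.any?
    (λ f → ¬? (f ≟ e) ×-dec (f ⊖ e ∈? disc)) units) units)
... | f , f∈ , f≢e , f⊖e∈ =
  u ⊖ f
  , (λ eq → All.lookup nonzero f∈ (trans (sym (⊖-⊖ u f)) (trans (cong (u ⊖_) eq) (u⊖u≡0 u))))
  , (λ eq → f≢e (trans (sym (⊖-⊖ u f)) (cong (u ⊖_) eq)))
  , ⊖-unit-neighbour u f∈
  , ⊖∈disc⇒N (subst (_∈ˡ disc)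
      (trans (sym (⊖-difference u (u ⊖ w) f)) (cong (_⊖ (u ⊖ f)) (⊖-⊖ u w))) f⊖e∈)
  where
  nonzero : All (_≢ (+ 0 , + 0)) units
  nonzero = from-yes (All.all? (λ e → ¬? (e ≟ (+ 0 , + 0))) units)

-- The even code has both properties.

parity : ∀ i → + 2 ∣ i ⊎ (+ 2 ∣ i ℤ.+ + 1) × (+ 2 ∣ i ℤ.- + 1)
parity i with i %ℕ 2 | n%ℕd<d i 2 | a≡a%ℕn+[a/ℕn]*n i 2
... | 0 | _ | eq = inj₁ (∣⇒∣ᵤ {+ 2} (Signed.divides (i /ℕ 2) (trans eq (ℤ.+-identityˡ _))))
... | 1 | _ | eq = inj₂
  ( ∣⇒∣ᵤ {+ 2} {i ℤ.+ + 1}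
      (Signed.divides (i /ℕ 2 ℤ.+ + 1) (trans (cong (ℤ._+ + 1) eq) (above (i /ℕ 2))))
  , ∣⇒∣ᵤ {+ 2} {i ℤ.- + 1}
      (Signed.divides (i /ℕ 2) (trans (cong (ℤ._- + 1) eq) (below (i /ℕ 2)))))
  where
  above : ∀ q → + 1 ℤ.+ q ℤ.* + 2 ℤ.+ + 1 ≡ (q ℤ.+ + 1) ℤ.* + 2
  above = ℤ-Solver.solve-∀
  below : ∀ q → + 1 ℤ.+ q ℤ.* + 2 ℤ.- + 1 ≡ q ℤ.* + 2
  below = ℤ-Solver.solve-∀
... | suc (suc _) | s≤s (s≤s ()) | _

opposite-codewords : ∀ u → u ∉ evenCode →
  ∃[ d ] d ∈ˡ units × u ⊕ d ∈ evenCode × u ⊖ d ∈ evenCode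
opposite-codewords (i , j) u∉ with parity i | parity j
... | inj₁ 2∣i | inj₁ 2∣j = contradiction (2∣i , 2∣j) u∉
... | inj₂ (2∣i+1 , 2∣i-1) | inj₁ 2∣j =
  (+ 1 , + 0) , here refl , (2∣i+1 , 2∣j+0) , (2∣i-1 , 2∣j+0)
  where 2∣j+0 = subst (+ 2 ∣_) (sym (ℤ.+-identityʳ j)) 2∣j
... | inj₁ 2∣i | inj₂ (2∣j+1 , 2∣j-1) =
  (+ 0 , + 1) , there (there (here refl)) , (2∣i+0 , 2∣j+1) , (2∣i+0 , 2∣j-1)
  where 2∣i+0 = subst (+ 2 ∣_) (sym (ℤ.+-identityʳ i)) 2∣i
... | inj₂ (2∣i+1 , 2∣i-1) | inj₂ (2∣j+1 , 2∣j-1) =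
  -- The sum and difference with (1, 1) would be even as well, but (1, 1) has norm 3 and is no unit.
  (+ 1 , - + 1) , there (there (there (there (here refl)))) , (2∣i+1 , 2∣j-1) , (2∣i-1 , 2∣j+1)

⊕-unit-neighbour : ∀ u {d} → d ∈ˡ units → u ⊕ d ∈ N[ u ]
⊕-unit-neighbour u {d} d∈ = N-sym (⊖∈disc⇒N (subst (_∈ˡ disc) (sym (lemma u d)) (there d∈)))
  where
  lem : ∀ i k → i ℤ.+ k ℤ.- i ≡ k
  lem = ℤ-Solver.solve-∀
  lemma : ∀ u d → (u ⊕ d) ⊖ u ≡ d
  lemma (i , j) (k , l) = cong₂ _,_ (lem i k) (lem j l)

evenCode-isCode : IsCode evenCode
evenCode-isCode = (+ 0 , + 0) , ℕ.divides 0 refl , ℕ.divides 0 refl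

evenCode-selfLocatingDominating : SelfLocatingDominating evenCode
evenCode-selfLocatingDominating = evenCode-isCode , λ u u∉ →
  let d , d∈ , u⊕d∈ , u⊖d∈ = opposite-codewords u u∉
      ⊕∈I = ⊕-unit-neighbour u d∈ , u⊕d∈
      ⊖∈I = ⊖-unit-neighbour u d∈ , u⊖d∈
  in (u ⊕ d , ⊕∈I)
   , (λ w∈⋂ → opposite-neighbours d∈ (w∈⋂ (u ⊕ d , ⊕∈I)) (w∈⋂ (u ⊖ d , ⊖∈I)))
   , λ { refl (c , c∈N , _) → N-sym c∈N }

-- A `v` adjacent or equal to both `u ⊕ d` and `u ⊖ d` would be `u`, so one of them separates.
-- Decidability of neighbourhoods tells which, as an actual witness is demanded.
evenCode-solidLocatingDominating : SolidLocatingDominating evenCode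
evenCode-solidLocatingDominating = evenCode-isCode , separate
  where
  separate : _
  separate u v u∉ v∉ u≢v with opposite-codewords u u∉
  ... | d , d∈ , u⊕d∈ , u⊖d∈ with N? v (u ⊕ d)
  ...   | no ⊕∉N  = u ⊕ d , (⊕-unit-neighbour u d∈ , u⊕d∈) , ⊕∉N ∘ proj₁
  ...   | yes ⊕∈N = u ⊖ d , (⊖-unit-neighbour u d∈ , u⊖d∈) ,
    λ (⊖∈N , _) → u≢v (opposite-neighbours d∈ (N-sym ⊕∈N) (N-sym ⊖∈N))

-- Separating codes and their non-codewords.

-- This is all that the density bound uses of either notion of code; unlike
-- solid location it follows constructively from self-location.
Separating : Pred V 0ℓ → Set
Separating C = ∀ {u v} → u ∉ C → v ∉ C → u ≢ v → ¬ (I C u ⊆ I C v)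

solid⇒separating : ∀ {C} → SolidLocatingDominating C → Separating C
solid⇒separating (_ , separate) u∉ v∉ u≢v Iu⊆Iv =
  let _ , c∈Iu , c∉Iv = separate _ _ u∉ v∉ u≢v in c∉Iv (Iu⊆Iv c∈Iu)

-- Under the inclusion, `v` lies in N[c] for every c in I(C;u), hence in the intersection, which is
-- {u}.
self⇒separating : ∀ {C} → SelfLocatingDominating C → Separating C
self⇒separating (_ , locate) u∉ v∉ u≢v Iu⊆Iv =
  u≢v (proj₁ (proj₂ (locate _ u∉)) λ (c , c∈Iu) → N-sym (proj₁ (Iu⊆Iv c∈Iu)))

-- Phrased as the failure of "at most one", because an undecidable `C` gives no means to exhibit two
-- codewords.
two-codewords : ∀ {C} → Separating C → ∀ {u} → u ∉ C →
  ¬ (∀ {c c′} → c ∈ I C u → c′ ∈ I C u → c ≡ c′)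
two-codewords {C} separating {u} u∉ unique =
  -- Having no codeword nearby is excluded too: the neighbour `w` is then no codeword, and the empty
  -- I(C;u) lies in I(C;w).
  separating u∉ w∉ (w≢u ∘ sym) (⊥-elim ∘ empty)
  where
  empty : ∀ {c} → c ∉ I C u
  empty {c} (c∈N , c∈C) with common-neighbour c∈N (λ { refl → u∉ c∈C })
  ... | x , x≢u , x≢c , x∈Nu , x∈Nc = separating u∉ x∉ (x≢u ∘ sym)
    λ c′∈I → subst (_∈ I C x) (unique (c∈N , c∈C) c′∈I) (N-sym x∈Nc , c∈C)
    where
    x∉ : x ∉ C
    x∉ x∈C = x≢c (unique (x∈Nu , x∈C) (c∈N , c∈C))
  d = + 1 , + 0
  w = u ⊖ d
  w∈N : w ∈ N[ u ]
  w∈N = ⊖-unit-neighbour u (here refl)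
  w∉ : w ∉ C
  w∉ w∈C = empty (w∈N , w∈C)
  w≢u : w ≢ u
  w≢u eq with () ← trans (sym (⊖-⊖ u d)) (trans (cong (u ⊖_) eq) (u⊖u≡0 u))

-- Counting with duplicate-free lists.

private
  variable
    A B : Set

lookup-injective : ∀ {xs : List A} → Unique xs → ∀ {i j} → lookup xs i ≡ lookup xs j → i ≡ j
lookup-injective (x∉ ∷ xs!) {Fin.zero}  {Fin.zero}  eq = refl
lookup-injective (x∉ ∷ xs!) {Fin.zero}  {Fin.suc j} eq =
  contradiction eq (All.lookup x∉ (∈-lookup j))
lookup-injective (x∉ ∷ xs!) {Fin.suc i} {Fin.zero}  eq =
  contradiction (sym eq) (All.lookup x∉ (∈-lookup i))
lookup-injective (x∉ ∷ xs!) {Fin.suc i} {Fin.suc j} eq = cong Fin.suc (lookup-injective xs! eq)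

-- Pigeonhole: sending each position in `xs` to the position of its entry in `ys` is injective.
unique-⊆⇒length≤ : ∀ {xs ys : List A} → Unique xs → xs ⊆ˡ ys → length xs ℕ.≤ length ys
unique-⊆⇒length≤ {xs = xs} {ys = ys} xs! xs⊆ys =
  Fin.injective⇒≤ {f = λ i → index (xs⊆ys (∈-lookup i))} λ {i} {j} eq →
    lookup-injective xs! (trans (lookup-index (xs⊆ys (∈-lookup i)))
      (trans (cong (lookup ys) eq) (sym (lookup-index (xs⊆ys (∈-lookup j))))))

HasCardinality-unique : ∀ {P : Pred A 0ℓ} {k l} → HasCardinality P k → HasCardinality P l → k ≡ l
HasCardinality-unique (xs , xs! , xs≐P , refl) (ys , ys! , ys≐P , refl) = ℕ.≤-antisym
  (unique-⊆⇒length≤ xs! (proj₂ ys≐P ∘ proj₁ xs≐P))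
  (unique-⊆⇒length≤ ys! (proj₂ xs≐P ∘ proj₁ ys≐P))

-- Induction on the list, with membership in `P` decided entry by entry under the double negation.
¬¬-subset-finite : (P : Pred A 0ℓ) {xs : List A} → Unique xs →
  ¬ ¬ ∃ (HasCardinality (P ∩ (_∈ˡ xs)))
¬¬-subset-finite P [] ¬finite = ¬finite (0 , [] , [] , ((λ ()) , λ ()) , refl)
¬¬-subset-finite P {x ∷ xs} (x∉ ∷ xs!) ¬finite =
  ¬¬-subset-finite P xs! λ { (k , ys , ys! , (ys⊆ , ⊆ys) , eq) →
  ¬¬-excluded-middle λ
    { (yes x∈P) → ¬finite (suc k , x ∷ ys
      , All.tabulate (λ y∈ → All.lookup x∉ (proj₂ (ys⊆ y∈))) ∷ ys!
      , ( (λ { (here refl) → x∈P , here refl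
             ; (there y∈)  → proj₁ (ys⊆ y∈) , there (proj₂ (ys⊆ y∈)) })
        , λ { (_ , here refl) → here refl
            ; (y∈P , there y∈) → there (⊆ys (y∈P , y∈)) })
      , cong suc eq)
    ; (no x∉P) → ¬finite (k , ys , ys!
      , ( (λ y∈ → proj₁ (ys⊆ y∈) , there (proj₂ (ys⊆ y∈)))
        , λ { (x∈P , here refl) → contradiction x∈P x∉P
            ; (y∈P , there y∈) → ⊆ys (y∈P , y∈) })
      , eq) } }

TwoPreimages : (B → A) → List B → Pred A 0ℓ
TwoPreimages f ts u =
  ∃[ s ] ∃[ t ] s ≢ t × (s ∈ˡ ts × f s ≡ u) × (t ∈ˡ ts × f t ≡ u)

-- Preimages of different values differ, so the chosen pairs together form a duplicate-free list
-- inside `ts`.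
two-preimages⇒length≤ : ∀ (f : B → A) {ts us} → Unique us →
  All (TwoPreimages f ts) us → length us ℕ.* 2 ℕ.≤ length ts
two-preimages⇒length≤ f {ts} us! two =
  let ss , ss! , ss⊆ , _ , eq = preimages us! two
  in subst (ℕ._≤ length ts) eq (unique-⊆⇒length≤ ss! ss⊆)
  where
  -- That `f` maps the collected entries into `us` is carried along to show that the next pair is
  -- fresh.
  preimages : ∀ {us} → Unique us → All (TwoPreimages f ts) us →
    ∃[ ss ] Unique ss × ss ⊆ˡ ts × (∀ {s} → s ∈ˡ ss → f s ∈ˡ us) × length ss ≡ length us ℕ.* 2
  preimages [] [] = [] , [] , (λ ()) , (λ ()) , refl
  preimages {u ∷ us} (u∉ ∷ us!) ((s , t , s≢t , (s∈ , fs≡u) , t∈ , ft≡u) ∷ two) =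
    let ss , ss! , ss⊆ , f∈ , eq = preimages us! two
        fresh : ∀ {r} → f r ≡ u → All (r ≢_) ss
        fresh fr≡u = All.tabulate λ { r∈ refl → All.lookup u∉ (f∈ r∈) (sym fr≡u) }
    in s ∷ t ∷ ss
     , (s≢t ∷ fresh fs≡u) ∷ fresh ft≡u ∷ ss!
     , (λ { (here refl) → s∈ ; (there (here refl)) → t∈ ; (there (there r∈)) → ss⊆ r∈ })
     , (λ { (here refl) → here fs≡u ; (there (here refl)) → here ft≡u
          ; (there (there r∈)) → there (f∈ r∈) })
     , cong (suc ∘ suc) eq

length-cartesianProduct : ∀ (xs : List A) (ys : List B) →
  length (cartesianProduct xs ys) ≡ length xs ℕ.* length ys
length-cartesianProduct []       ys = refl
length-cartesianProduct (x ∷ xs) ys = trans (length-++ (map (x ,_) ys))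
  (cong₂ ℕ._+_ (length-map (x ,_) ys) (length-cartesianProduct xs ys))

-- The squares V_n and their boundaries.

length-range : ∀ n → length (range n) ≡ suc (2 ℕ.* n)
length-range zero    = refl
length-range (suc n) = trans (cong (suc ∘ suc) (length-range n)) (cong suc (sym (ℕ.*-suc 2 n)))

range-unique : ∀ n → Unique (range n)
range-unique zero    = [] ∷ []
range-unique (suc n) = ((λ ()) ∷ fresh ℕ.≤-refl) ∷ fresh ℕ.≤-refl ∷ range-unique n
  where
  fresh : ∀ {i} → n ℕ.< ∣ i ∣ → All (i ≢_) (range n)
  fresh n<∣i∣ = All.tabulate λ { i∈ refl → ℕ.<⇒≱ n<∣i∣ (∈-range⁻ i∈) }

square-unique : ∀ n → Unique (square n)
square-unique n = Unique.cartesianProduct⁺ (range-unique n) (range-unique n)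

size : ℕ → ℕ
size n = suc (2 ℕ.* n) ℕ.* suc (2 ℕ.* n)

length-square : ∀ n → length (square n) ≡ size n
length-square n = trans (length-cartesianProduct (range n) (range n))
  (cong₂ ℕ._*_ (length-range n) (length-range n))

square≐V : ∀ n → (_∈ˡ square n) ≐ V[ n ]
square≐V n =
  (λ u∈ → let i∈ , j∈ = ∈-cartesianProduct⁻ (range n) (range n) u∈ in ∈-range⁻ i∈ , ∈-range⁻ j∈)
  , λ (i≤n , j≤n) → ∈-cartesianProduct⁺ (∈-range⁺ i≤n) (∈-range⁺ j≤n)

V-cardinality : ∀ n → HasCardinality V[ n ] (size n)
V-cardinality n = square n , square-unique n , square≐V n , length-square n

¬¬-code-cardinality : ∀ C n → ¬ ¬ ∃ (HasCardinality (C ∩ V[ n ]))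
¬¬-code-cardinality C n ¬finite = ¬¬-subset-finite C (square-unique n)
  λ (k , xs , xs! , (xs⊆ , ⊆xs) , eq) → ¬finite (k , xs , xs!
    , ( (λ u∈ → let u∈C , u∈□ = xs⊆ u∈ in u∈C , proj₁ (square≐V n) u∈□)
      , λ (u∈C , u∈V) → ⊆xs (u∈C , proj₂ (square≐V n) u∈V))
    , eq)

N-V : ∀ {n u c} → u ∈ V[ n ] → c ∈ N[ u ] → c ∈ V[ suc n ]
N-V {n} {i , j} {k , l} (i≤n , j≤n) c∈N =
  let k-i≤1 , l-j≤1 = All.lookup small (N⇒⊖∈disc (N-sym c∈N))
  in bound i k i≤n k-i≤1 , bound j l j≤n l-j≤1
  where
  small : All (λ (a , b) → ∣ a ∣ ℕ.≤ 1 × ∣ b ∣ ℕ.≤ 1) disc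
  small = from-yes (All.all? (λ (a , b) → (∣ a ∣ ℕ.≤? 1) ×-dec (∣ b ∣ ℕ.≤? 1)) disc)
  rearrange : ∀ i k → k ≡ (k ℤ.- i) ℤ.+ i
  rearrange = ℤ-Solver.solve-∀
  bound : ∀ i k → ∣ i ∣ ℕ.≤ n → ∣ k ℤ.- i ∣ ℕ.≤ 1 → ∣ k ∣ ℕ.≤ suc n
  bound i k i≤n k-i≤1 = begin
    ∣ k ∣                     ≡⟨ cong ∣_∣ (rearrange i k) ⟩
    ∣ (k ℤ.- i) ℤ.+ i ∣       ≤⟨ ℤ.∣i+j∣≤∣i∣+∣j∣ (k ℤ.- i) i ⟩
    ∣ k ℤ.- i ∣ ℕ.+ ∣ i ∣     ≤⟨ ℕ.+-mono-≤ k-i≤1 i≤n ⟩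
    suc n ∎
    where open ℕ.≤-Reasoning

-- Double counting of tokens.

-- Of the eight tokens of a codeword c, two point at c itself (the added zero
-- and the head of disc) and six at the neighbours of c.
target : V × Fin 8 → V
target (c , i) = c ⊕ lookup ((+ 0 , + 0) ∷ disc) i

tokens : List V → List (V × Fin 8)
tokens cs = cartesianProduct cs (allFin 8)

module _ {C : Pred V 0ℓ} (separating : Separating C) where

  two-tokens : ∀ {n cs} → (_∈ˡ cs) ≐ C ∩ V[ suc n ] → ∀ {u} → u ∈ V[ n ] →
    ¬ ¬ TwoPreimages target (tokens cs) u
  two-tokens {n} {cs} (_ , ⊆cs) {u} u∈V ¬two = ¬¬-excluded-middle λ
    { (yes u∈C) → ¬two ((u , Fin.zero) , (u , Fin.suc Fin.zero) , (λ ())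
      , (token u∈C (inj₁ refl) Fin.zero , u⊕0≡u u)
      , token u∈C (inj₁ refl) (Fin.suc Fin.zero) , u⊕0≡u u)
    ; (no u∉C) → two-codewords separating u∉C λ (c∈N , c∈C) (c′∈N , c′∈C) →
        -- Equality of vertices is decidable, so uniqueness may be refuted by assuming that the two
        -- codewords differ.
        decidable-stable (_ ≟ _) λ c≢c′ → ¬two
          ((_ , direction c∈N) , (_ , direction c′∈N) , c≢c′ ∘ cong proj₁
          , (token c∈C c∈N _ , target-direction c∈N)
          , token c′∈C c′∈N _ , target-direction c′∈N)
    }
    where
    u⊕0≡u : ∀ u → u ⊕ (+ 0 , + 0) ≡ u
    u⊕0≡u (i , j) = cong₂ _,_ (ℤ.+-identityʳ i) (ℤ.+-identityʳ j)
    token : ∀ {c} → c ∈ C → c ∈ N[ u ] → ∀ i → (c , i) ∈ˡ tokens cs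
    token c∈C c∈N i = ∈-cartesianProduct⁺ (⊆cs (c∈C , N-V u∈V c∈N)) (∈-allFin i)
    direction : ∀ {c} → c ∈ N[ u ] → Fin 8
    -- The successor passes over the added zero in front of `disc`.
    direction c∈N = Fin.suc (index (N⇒⊖∈disc c∈N))
    target-direction : ∀ {c} (c∈N : c ∈ N[ u ]) → target (c , direction c∈N) ≡ u
    target-direction {c} c∈N =
      trans (cong (c ⊕_) (sym (lookup-index (N⇒⊖∈disc c∈N)))) (⊕-⊖ u c)

  separating-cardinality : ∀ {n k} → HasCardinality (C ∩ V[ suc n ]) k →
    size n ℕ.≤ 4 ℕ.* k
  separating-cardinality {n} {k} (cs , _ , cs≐ , refl) = decidable-stable (_ ℕ.≤? _) λ ≰ →
    -- The goal is a decidable inequality, hence stable, and the double negations can be collected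
    -- over the finitely many vertices of the square.
    All.sequenceM 0ℓ ¬¬-Monad
      (All.tabulate (λ {u} u∈ → two-tokens cs≐ (proj₁ (square≐V n) u∈)))
      λ two → ≰ (ℕ.*-cancelʳ-≤ _ _ 2 (begin
        size n ℕ.* 2 ≡⟨ cong (ℕ._* 2) (length-square n) ⟨
        length (square n) ℕ.* 2  ≤⟨ two-preimages⇒length≤ target (square-unique n) two ⟩
        length (tokens cs)       ≡⟨ length-cartesianProduct cs (allFin 8) ⟩
        length cs ℕ.* 8          ≡⟨ eight (length cs) ⟩
        4 ℕ.* length cs ℕ.* 2    ∎))
    where
    open ℕ.≤-Reasoning
    eight : ∀ k → k ℕ.* 8 ≡ 4 ℕ.* k ℕ.* 2
    eight = ℕ-Solver.solve-∀

-- The number of even codewords in V_n.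

*2-injective : ∀ {i j} → i ℤ.* + 2 ≡ j ℤ.* + 2 → i ≡ j
*2-injective = ℤ.*-cancelʳ-≡ _ _ (+ 2)

double : V → V
double (i , j) = i ℤ.* + 2 , j ℤ.* + 2

double-injective : ∀ {u w} → double u ≡ double w → u ≡ w
double-injective eq = cong₂ _,_ (*2-injective (cong proj₁ eq)) (*2-injective (cong proj₂ eq))

-- Doubling is a bijection from the square of radius ⌊n/2⌋ onto the even codewords of V_n.
evenCode-cardinality : ∀ n → HasCardinality (evenCode ∩ V[ n ])
  (size (n ℕ./ 2))
evenCode-cardinality n = map double (square h)
  , Unique.map⁺ double-injective (square-unique h)
  , (to , from)
  , trans (length-map double (square h)) (length-square h)
  where
  h = n ℕ./ 2
  even : ∀ i → + 2 ∣ i ℤ.* + 2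
  even i = ∣⇒∣ᵤ {+ 2} (Signed.divides i refl)
  bound : ∀ i → ∣ i ∣ ℕ.≤ h → ∣ i ℤ.* + 2 ∣ ℕ.≤ n
  bound i i≤h = begin
    ∣ i ℤ.* + 2 ∣  ≡⟨ ℤ.abs-* i (+ 2) ⟩
    ∣ i ∣ ℕ.* 2    ≤⟨ ℕ.*-monoˡ-≤ 2 i≤h ⟩
    h ℕ.* 2        ≤⟨ ℕ.m/n*n≤m n 2 ⟩
    n              ∎
    where open ℕ.≤-Reasoning
  to : ∀ {u} → u ∈ˡ map double (square h) → u ∈ evenCode ∩ V[ n ]
  to u∈ with ∈-map⁻ double u∈
  ... | (i , j) , w∈ , refl = let i≤h , j≤h = proj₁ (square≐V h) w∈ in
    (even i , even j) , bound i i≤h , bound j j≤h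
  half : ∀ i → + 2 ∣ i → ∣ i ∣ ℕ.≤ n → ∃[ k ] ∣ k ∣ ℕ.≤ h × i ≡ k ℤ.* + 2
  half i 2∣i i≤n with ∣ᵤ⇒∣ {+ 2} {i} 2∣i
  ... | Signed.divides k refl = k , (begin
    ∣ k ∣                    ≡⟨ ℕ.m*n/n≡m ∣ k ∣ 2 ⟨
    ∣ k ∣ ℕ.* 2 ℕ./ 2        ≡⟨ ℕ./-congˡ (ℤ.abs-* k (+ 2)) ⟨
    ∣ k ℤ.* + 2 ∣ ℕ./ 2      ≤⟨ ℕ./-monoˡ-≤ 2 i≤n ⟩
    n ℕ./ 2                  ∎) , refl
    where open ℕ.≤-Reasoning
  from : ∀ {u} → u ∈ evenCode ∩ V[ n ] → u ∈ˡ map double (square h)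
  from {i , j} ((2∣i , 2∣j) , i≤n , j≤n) with half i 2∣i i≤n | half j 2∣j j≤n
  ... | k , k≤h , refl | l , l≤h , refl =
    ∈-map⁺ double {x = k , l} (proj₂ (square≐V h) (k≤h , l≤h))

-- Density estimates and the limit superior.

open ℚ.ℚ using (denominator-1)

-- As q ≠ 1/4, the integers 4 * ↥ q and ↧ q differ by at least 1; for large n
-- this absorbs the difference between the sizes of consecutive squares.
density-lower : ∀ q n k → q ℚ.< + 1 / 4 → 2 ℕ.* denominator-1 q ℕ.≤ n →
  size n ℕ.≤ 4 ℕ.* k → q ℚ.≤ + k / size (suc n)
density-lower (mkℚ a b _) n k (ℚ.*<* a*4<1+b) 2b≤n size≤4k =
  ℚ.toℚᵘ-cancel-≤ (ℚᵘ.≤-trans (ℚᵘ.*≤* (ℤ.*-cancelʳ-≤-pos _ _ (+ 4) (begin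
    a ℤ.* + size (suc n) ℤ.* + 4 ≡⟨ swap a (+ size (suc n)) ⟩
    a ℤ.* + 4 ℤ.* + size (suc n) ≤⟨ ℤ.*-monoʳ-≤-nonNeg (+ size (suc n)) a*4≤b ⟩
    + b ℤ.* + size (suc n)       ≡⟨ ℤ.pos-* b (size (suc n)) ⟨
    + (b ℕ.* size (suc n))       ≤⟨ ℤ.+≤+ (ℕ.≤-trans boundary (ℕ.*-monoʳ-≤ (suc b) size≤4k)) ⟩
    + (suc b ℕ.* (4 ℕ.* k))      ≡⟨ cong +_ (swapℕ (suc b) k) ⟩
    + (k ℕ.* suc b ℕ.* 4)        ≡⟨ ℤ.pos-* (k ℕ.* suc b) 4 ⟩
    + (k ℕ.* suc b) ℤ.* + 4      ≡⟨ cong (ℤ._* + 4) (ℤ.pos-* k (suc b)) ⟩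
    + k ℤ.* + suc b ℤ.* + 4 ∎)))
    (ℚᵘ.≤-reflexive (ℚᵘ.≃-sym (ℚ.toℚᵘ-fromℚᵘ (mkℚᵘ (+ k) _)))))
  where
  open ℤ.≤-Reasoning
  a*4≤b : a ℤ.* + 4 ℤ.≤ + b
  a*4≤b = ℤ.i<j⇒i≤pred[j] (subst (a ℤ.* + 4 ℤ.<_) (ℤ.*-identityˡ (+ suc b)) a*4<1+b)
  swap : ∀ i j → i ℤ.* j ℤ.* + 4 ≡ i ℤ.* + 4 ℤ.* j
  swap = ℤ-Solver.solve-∀
  swapℕ : ∀ b k → b ℕ.* (4 ℕ.* k) ≡ k ℕ.* b ℕ.* 4
  swapℕ = ℕ-Solver.solve-∀
  expand : ∀ b n → b ℕ.* (suc (2 ℕ.* suc n) ℕ.* suc (2 ℕ.* suc n)) ≡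
    2 ℕ.* b ℕ.* (4 ℕ.* n ℕ.+ 4) ℕ.+ b ℕ.* (suc (2 ℕ.* n) ℕ.* suc (2 ℕ.* n))
  expand = ℕ-Solver.solve-∀
  complete : ∀ n → suc (n ℕ.* (4 ℕ.* n ℕ.+ 4)) ≡ suc (2 ℕ.* n) ℕ.* suc (2 ℕ.* n)
  complete = ℕ-Solver.solve-∀
  -- The sizes differ by 2(4n + 4), and 2b(4n + 4) ≤ n(4n + 4) = `size n` - 1; hence the threshold
  -- 2b ≤ n.
  boundary : b ℕ.* size (suc n) ℕ.≤ suc b ℕ.* size n
  boundary = subst₂ ℕ._≤_ (sym (expand b n)) (cong (ℕ._+ b ℕ.* size n) (complete n))
    (ℕ.+-monoˡ-≤ (b ℕ.* size n) (ℕ.m≤n⇒m≤1+n (ℕ.*-monoˡ-≤ (4 ℕ.* n ℕ.+ 4) 2b≤n)))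

-- Writing q = a/(b + 1), q > 1/4 gives 4a ≥ b + 2. As 4(n + 1)² exceeds `size n` by 4n + 3, the
-- excess (b + 1)(4n + 3) is at most n(4n + 3) ≤ `size n` once n > b, and the extra unit in b + 2
-- pays for it.
density-upper : ∀ q n k → + 1 / 4 ℚ.< q → suc (denominator-1 q) ℕ.≤ n →
  k ℕ.≤ suc n ℕ.* suc n → + k / size n ℚ.≤ q
density-upper (mkℚ a b _) n k (ℚ.*<* 1+b<a*4) 1+b≤n k≤ =
  ℚ.toℚᵘ-cancel-≤ (ℚᵘ.≤-trans
    (ℚᵘ.≤-reflexive (ℚ.toℚᵘ-fromℚᵘ (mkℚᵘ (+ k) _)))
    (ℚᵘ.*≤* (ℤ.*-cancelʳ-≤-pos _ _ (+ 4) (begin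
    + k ℤ.* + suc b ℤ.* + 4       ≡⟨ cong (ℤ._* + 4) (ℤ.pos-* k (suc b)) ⟨
    + (k ℕ.* suc b) ℤ.* + 4       ≡⟨ ℤ.pos-* (k ℕ.* suc b) 4 ⟨
    + (k ℕ.* suc b ℕ.* 4)         ≤⟨ ℤ.+≤+ (ℕ.*-monoˡ-≤ 4 (ℕ.*-monoˡ-≤ (suc b) k≤)) ⟩
    + (suc n ℕ.* suc n ℕ.* suc b ℕ.* 4) ≤⟨ ℤ.+≤+ boundary ⟩
    + (suc (suc b) ℕ.* size n)    ≡⟨ ℤ.pos-* (suc (suc b)) (size n) ⟩
    + suc (suc b) ℤ.* + size n    ≤⟨ ℤ.*-monoʳ-≤-nonNeg (+ size n) 2+b≤a*4 ⟩
    a ℤ.* + 4 ℤ.* + size n        ≡⟨ swap a (+ size n) ⟨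
    a ℤ.* + size n ℤ.* + 4 ∎))))
  where
  open ℤ.≤-Reasoning
  2+b≤a*4 : + suc (suc b) ℤ.≤ a ℤ.* + 4
  2+b≤a*4 = ℤ.i<j⇒suc[i]≤j (subst (ℤ._< a ℤ.* + 4) (ℤ.*-identityˡ (+ suc b)) 1+b<a*4)
  swap : ∀ i j → i ℤ.* j ℤ.* + 4 ≡ i ℤ.* + 4 ℤ.* j
  swap = ℤ-Solver.solve-∀
  expand : ∀ b n → suc n ℕ.* suc n ℕ.* b ℕ.* 4 ≡
    b ℕ.* (4 ℕ.* n ℕ.+ 3) ℕ.+ b ℕ.* (suc (2 ℕ.* n) ℕ.* suc (2 ℕ.* n))
  expand = ℕ-Solver.solve-∀
  complete : ∀ n → n ℕ.* (4 ℕ.* n ℕ.+ 3) ℕ.+ suc n ≡ suc (2 ℕ.* n) ℕ.* suc (2 ℕ.* n)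
  complete = ℕ-Solver.solve-∀
  boundary : suc n ℕ.* suc n ℕ.* suc b ℕ.* 4 ℕ.≤ suc (suc b) ℕ.* size n
  boundary = subst₂ ℕ._≤_ (sym (expand (suc b) n)) (cong (ℕ._+ suc b ℕ.* size n) (complete n))
    (ℕ.+-monoˡ-≤ (suc b ℕ.* size n)
      (ℕ.≤-trans (ℕ.*-monoˡ-≤ (4 ℕ.* n ℕ.+ 3) 1+b≤n) (ℕ.m≤m+n _ (suc n))))

separating-density : ∀ {C} → Separating C → ¬ Density C < (+ 1 / 4)
separating-density {C} separating (p , p<¼ , N , ≤p) =
  -- The term at `suc n` would be at least `q` by counting and at most `p` by assumption, so `q` is
  -- chosen strictly above `p`.
  let q , p<q , q<¼ = ℚ.<-dense p<¼
      n = N ℕ.⊔ 2 ℕ.* denominator-1 q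
  in ¬¬-code-cardinality C (suc n) λ (k , card) → ℚ.<-irrefl refl (ℚ.<-≤-trans p<q (ℚ.≤-trans
    (density-lower q n k q<¼ (ℕ.m≤n⊔m N _) (separating-cardinality separating card))
    (≤p (suc n) (ℕ.m≤n⇒m≤1+n (ℕ.m≤m⊔n N _)) _ (k , _ , card , V-cardinality (suc n) , refl))))

evenCode-density : Density evenCode ≈ (+ 1 / 4)
evenCode-density = above , below
  where
  n≤1+2h : ∀ n → n ℕ.≤ suc (2 ℕ.* (n ℕ./ 2))
  n≤1+2h n = begin
    n                            ≡⟨ ℕ.m≡m%n+[m/n]*n n 2 ⟩
    n ℕ.% 2 ℕ.+ (n ℕ./ 2) ℕ.* 2  ≤⟨ ℕ.+-monoˡ-≤ _ (ℕ.≤-pred (ℕ.m%n<n n 2)) ⟩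
    suc ((n ℕ./ 2) ℕ.* 2)        ≡⟨ cong suc (ℕ.*-comm (n ℕ./ 2) 2) ⟩
    suc (2 ℕ.* (n ℕ./ 2))        ∎
    where open ℕ.≤-Reasoning
  1+2h≤1+n : ∀ n → suc (2 ℕ.* (n ℕ./ 2)) ℕ.≤ suc n
  1+2h≤1+n n = s≤s (subst (ℕ._≤ n) (ℕ.*-comm (n ℕ./ 2) 2) (ℕ.m/n*n≤m n 2))
  -- The hypothesis of `density-lower` for the even codewords of V_(n+1): 2n + 1 ≤ 2(n + 1) ≤ 2(2⌊(n
  -- + 1)/2⌋ + 1), squared.
  size≤ : ∀ n → size n ℕ.≤ 4 ℕ.* size (suc n ℕ./ 2)
  size≤ n = begin
    size n                      ≤⟨ ℕ.*-mono-≤ side≤ side≤ ⟩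
    2 ℕ.* suc n ℕ.* (2 ℕ.* suc n) ≡⟨ ℕ.[m*n]*[o*p]≡[m*o]*[n*p] 2 (suc n) 2 (suc n) ⟩
    4 ℕ.* (suc n ℕ.* suc n)     ≤⟨ ℕ.*-monoʳ-≤ 4 (ℕ.*-mono-≤ (n≤1+2h (suc n)) (n≤1+2h (suc n))) ⟩
    4 ℕ.* size (suc n ℕ./ 2)    ∎
    where
    open ℕ.≤-Reasoning
    side≤ : suc (2 ℕ.* n) ℕ.≤ 2 ℕ.* suc n
    side≤ = subst (suc (2 ℕ.* n) ℕ.≤_) (sym (ℕ.*-suc 2 n)) (ℕ.n≤1+n _)
  above : ∀ p → + 1 / 4 ℚ.< p → LimSup densities evenCode < p
  above p ¼<p =
    let q , ¼<q , q<p = ℚ.<-dense ¼<p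
    in q , q<p , suc (denominator-1 q) , λ { n b<n _ (k , m , card , cardV , refl) →
      bounded q ¼<q b<n
        (HasCardinality-unique card (evenCode-cardinality n))
        (HasCardinality-unique cardV (V-cardinality n)) }
    where
    -- Taking the equations as arguments lets `refl` replace the arbitrary cardinalities in
    -- `densities` by the computed ones.
    bounded : ∀ q {n k m} → + 1 / 4 ℚ.< q → suc (denominator-1 q) ℕ.≤ n →
      k ≡ size (n ℕ./ 2) → suc m ≡ size n → + k / suc m ℚ.≤ q
    bounded q {n} ¼<q b<n refl refl =
      density-upper q n (size (n ℕ./ 2)) ¼<q b<n (ℕ.*-mono-≤ (1+2h≤1+n n) (1+2h≤1+n n))
  below : ∀ p → p ℚ.< + 1 / 4 → LimSup densities evenCode > p
  below p p<¼ =
    let q , p<q , q<¼ = ℚ.<-dense p<¼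
    in q , p<q , λ N → let n = N ℕ.⊔ 2 ℕ.* denominator-1 q in
      suc n , ℕ.m≤n⇒m≤1+n (ℕ.m≤m⊔n N _) , _
      , (_ , _ , evenCode-cardinality (suc n) , V-cardinality (suc n) , refl)
      , density-lower q n (size (suc n ℕ./ 2)) q<¼ (ℕ.m≤n⊔m N _) (size≤ n)

theorem7 : SelfLocatingDominating evenCode
    × SolidLocatingDominating evenCode
    × (Density evenCode ≈ (+ 1 / 4))
    × ¬ (∃[ C ] SelfLocatingDominating C × (Density C < (+ 1 / 4)))
    × ¬ (∃[ C ] SolidLocatingDominating C × (Density C < (+ 1 / 4)))
theorem7 =
    evenCode-selfLocatingDominating
  , evenCode-solidLocatingDominating
  , evenCode-density
  , (λ (_ , self , density<¼) → separating-density (self⇒separating self) density<¼)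
  , (λ (_ , solid , density<¼) → separating-density (solid⇒separating solid) density<¼)
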